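{- Let $\Gamma$ be an s-theory and let $\phi$ be an s-formula. Then $\phi$ is a strict consequence of $\Gamma$ if and only if there is a closed tableau for $\Gamma\cup\{ -\phi\}$.
   Context: Fix an infinite (possibly uncountable) set $\Sigma$ of propositional variables. Propositional formulas are built from $\Sigma$ using $\lnot$, $\land$, $\lor$, $\to$. An s-formula is an expression of the form $A \prec B$ (a strict implication) or $A \not\prec B$ (a strict nonimplication), where $A$ and $B$ are propositional formulas; $\prec$ and $\not\prec$ are two formal symbols, not nested. An s-theory is an arbitrary (possibly infinite) set of s-formulas. The strict negation $-\phi$ of an s-formula $\phi$ is defined by: $-(A\prec B)$ is $A\not\prec B$, and $-(A\not\prec B)$ is $A\prec B$. A valuation is a function $w:\Sigma\to\{T,F\}$, extended in the usual way to all propositional formulas. A frame is a nonempty set of valuations. A frame $R$ satisfies $A \prec B$ if for every $w\in R$, $w(A)=F$ or $w(B)=T$. A frame $R$ satisfies $A\not\prec B$ if there is some $w\in R$ with $w(A)=T$ and $w(B)=F$. A frame satisfies an s-theory if it satisfies every member. An s-formula $\phi$ is a strict consequence of an s-theory $\Gamma$ if every frame that satisfies $\Gamma$ satisfies $\phi$. Fix an infinite set $W$ of world variables. A tableau formula is either an s-formula or an expression $(A,w)$ with $A$ a propositional formula and $w\in W$. A tableau for a set $\Gamma$ of tableau formulas is a finite tree whose nodes are labeled by (possibly infinite) sets of tableau formulas, whose root is labeled $\Gamma$, and in which the children of each non-leaf node are obtained from that node by one of the following rules. Below, $\Delta$ is any set of tableau formulas, "$\Delta,\varphi$" means $\Delta\cup\{\varphi\}$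 ($\Delta$ may itself contain $\varphi$), the label of the parent is on the left of $\Rightarrow$ and the labels of its one or two children (separated by $\mid$) are on the right: - ($\lor$) $\Delta,(A\lor B,w)\Rightarrow \Delta,(A,w)\mid \Delta,(B,w)$ - ($\lnot\lor$) $\Delta,(\lnot(A\lor B),w)\Rightarrow \Delta,(\lnot A,w),(\lnot B,w)$ - ($\land$) $\Delta,(A\land B,w)\Rightarrow \Delta,(A,w),(B,w)$ - ($\lnot\land$) $\Delta,(\lnot(A\land B),w)\Rightarrow \Delta,(\lnot A,w)\mid \Delta,(\lnot B,w)$ - ($\to$) $\Delta,(A\to B,w)\Rightarrow \Delta,(\lnot A,w)\mid\Delta,(B,w)$ - ($\lnot\to$) $\Delta,(\lnot(A\to B),w)\Rightarrow\Delta,(A,w),(\lnot B,w)$ - ($\prec$) $\Delta, A\prec B\Rightarrow \Delta,(\lnot A,w)\mid\Delta,(B,w)$, for any $w\in W$ - ($\not\prec$) $\Delta, A\not\prec B\Rightarrow \Delta,(A,v),(\lnot B,v)$, where $v\in W$ is new: it is not mentioned in the label of the node where the rule is applied or of any of its ancestors - ($C$) $\Delta\Rightarrow \Delta,(A,w)\mid\Delta,(\lnot A,w)$, for any propositional formula $A$ and $w\in W$ - ($\lnot\lnot$) $\Delta,(\lnot\lnot A,w)\Rightarrow\Delta,(A,w)$. A branch is closed if it contains a node whose label contains both $(A,w)$ and $(\lnot A,w)$ for some propositional formula $A$ and some $w\in W$. A tableau is closed if every maximal branch is closed. -}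

module Defs where

open import Data.Bool.Base using (Bool; true; false; not) renaming (_∧_ to _&&_; _∨_ to _||_)
open import Data.Empty using (⊥)
open import Data.Fin.Base using (Fin)
open import Data.List.Base using (List; []; _∷_)
open import Data.List.Relation.Unary.All using (All)
open import Data.List.Relation.Unary.Any using (Any)
open import Data.Nat.Base using (ℕ)
open import Data.Product.Base using (∃; _×_)
open import Data.Sum.Base using (_⊎_)
open import Function.Bundles using (_↔_)
open import Level using (0ℓ)
open import Relation.Binary.PropositionalEquality.Core using (_≡_)
open import Relation.Nullary.Negation.Core using (¬_)
open import Relation.Unary using (Pred; _∈_; _∪_; ｛_｝; _≐_; Satisfiable)

Infinite : Set → Set
Infinite A = ¬ (∃ λ (n : ℕ) → A ↔ Fin n)

infix  9 ¬ᶠ_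
infixr 8 _∧ᶠ_
infixr 7 _∨ᶠ_
infixr 6 _→ᶠ_
infix  5 _≺_ _⊀_ _at_

data Formula (V : Set) : Set where
  var            : V → Formula V
  ¬ᶠ_            : Formula V → Formula V
  _∧ᶠ_ _∨ᶠ_ _→ᶠ_ : Formula V → Formula V → Formula V

data SFormula (V : Set) : Set where
  _≺_ _⊀_ : Formula V → Formula V → SFormula V

STheory : Set → Set₁
STheory V = Pred (SFormula V) 0ℓ

-ˢ_ : {V : Set} → SFormula V → SFormula V
-ˢ (A ≺ B) = A ⊀ B
-ˢ (A ⊀ B) = A ≺ B

Valuation : Set → Set
Valuation V = V → Bool

eval : {V : Set} → Valuation V → Formula V → Bool
eval w (var p)  = w p
eval w (¬ᶠ A)   = not (eval w A)
eval w (A ∧ᶠ B) = eval w A && eval w B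
eval w (A ∨ᶠ B) = eval w A || eval w B
eval w (A →ᶠ B) = not (eval w A) || eval w B

record Frame (V : Set) : Set₁ where
  field
    valuations : Pred (Valuation V) 0ℓ
    nonempty   : Satisfiable valuations

infix 4 _⊨_ _⊨ᵗ_

_⊨_ : {V : Set} → Frame V → SFormula V → Set
R ⊨ A ≺ B = ∀ w → w ∈ Frame.valuations R → eval w A ≡ false ⊎ eval w B ≡ true
R ⊨ A ⊀ B = ∃ λ w → w ∈ Frame.valuations R × eval w A ≡ true × eval w B ≡ false

_⊨ᵗ_ : {V : Set} → Frame V → STheory V → Set
R ⊨ᵗ Γ = ∀ φ → φ ∈ Γ → R ⊨ φ

StrictConsequence : {V : Set} → STheory V → SFormula V → Set₁
StrictConsequence Γ φ = ∀ R → R ⊨ᵗ Γ → R ⊨ φ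

data TFormula (V W : Set) : Set where
  strict : SFormula V → TFormula V W
  _at_   : Formula V → W → TFormula V W

Label : Set → Set → Set₁
Label V W = Pred (TFormula V W) 0ℓ

⌜_⌝ : {V W : Set} → STheory V → Label V W
⌜ Γ ⌝ (strict φ) = φ ∈ Γ
⌜ Γ ⌝ (A at w)   = ⊥

module _ {V W : Set} where

  infixl 5 _⨾_
  infix  4 _⊢_⟶_ _⟶_∣_

  _⨾_ : Label V W → TFormula V W → Label V W
  Δ ⨾ φ = Δ ∪ ｛ φ ｝

  Mentions : W → Label V W → Set
  Mentions v Γ = ∃ λ A → (A at v) ∈ Γ

  -- Parent labels are matched up to _≐_, since labels are sets: a predicate
  -- need not be literally of the form Δ ⨾ φ to denote such a set.

  -- path ⊢ Γ ⟶ Γ′: a rule with one child, applied at a node labelled Γ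
  -- whose proper ancestors have the labels listed in path.
  data _⊢_⟶_ (path : List (Label V W)) (Γ : Label V W) : Label V W → Set₁ where
    ¬∨-rule : ∀ Δ A B w → Γ ≐ Δ ⨾ (¬ᶠ (A ∨ᶠ B) at w) →
              path ⊢ Γ ⟶ Δ ⨾ (¬ᶠ A at w) ⨾ (¬ᶠ B at w)
    ∧-rule  : ∀ Δ A B w → Γ ≐ Δ ⨾ (A ∧ᶠ B at w) →
              path ⊢ Γ ⟶ Δ ⨾ (A at w) ⨾ (B at w)
    ¬→-rule : ∀ Δ A B w → Γ ≐ Δ ⨾ (¬ᶠ (A →ᶠ B) at w) →
              path ⊢ Γ ⟶ Δ ⨾ (A at w) ⨾ (¬ᶠ B at w)
    ⊀-rule  : ∀ Δ A B v → Γ ≐ Δ ⨾ strict (A ⊀ B) →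
              All (λ Γ′ → ¬ Mentions v Γ′) (Γ ∷ path) →
              path ⊢ Γ ⟶ Δ ⨾ (A at v) ⨾ (¬ᶠ B at v)
    ¬¬-rule : ∀ Δ A w → Γ ≐ Δ ⨾ (¬ᶠ ¬ᶠ A at w) →
              path ⊢ Γ ⟶ Δ ⨾ (A at w)

  data _⟶_∣_ (Γ : Label V W) : Label V W → Label V W → Set₁ where
    ∨-rule  : ∀ Δ A B w → Γ ≐ Δ ⨾ (A ∨ᶠ B at w) →
              Γ ⟶ Δ ⨾ (A at w) ∣ Δ ⨾ (B at w)
    ¬∧-rule : ∀ Δ A B w → Γ ≐ Δ ⨾ (¬ᶠ (A ∧ᶠ B) at w) →
              Γ ⟶ Δ ⨾ (¬ᶠ A at w) ∣ Δ ⨾ (¬ᶠ B at w)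
    →-rule  : ∀ Δ A B w → Γ ≐ Δ ⨾ (A →ᶠ B at w) →
              Γ ⟶ Δ ⨾ (¬ᶠ A at w) ∣ Δ ⨾ (B at w)
    ≺-rule  : ∀ Δ A B w → Γ ≐ Δ ⨾ strict (A ≺ B) →
              Γ ⟶ Δ ⨾ (¬ᶠ A at w) ∣ Δ ⨾ (B at w)
    C-rule  : ∀ Δ A w → Γ ≐ Δ →
              Γ ⟶ Δ ⨾ (A at w) ∣ Δ ⨾ (¬ᶠ A at w)

  -- path lists the labels of the proper ancestors of the root, nearest first;
  -- only freshness in the ⊀-rule depends on it.
  data Subtableau (path : List (Label V W)) (Γ : Label V W) : Set₁ where
    leaf   : Subtableau path Γ
    unary  : ∀ {Γ′} → path ⊢ Γ ⟶ Γ′ →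
             Subtableau (Γ ∷ path) Γ′ → Subtableau path Γ
    binary : ∀ {Γ₁ Γ₂} → Γ ⟶ Γ₁ ∣ Γ₂ →
             Subtableau (Γ ∷ path) Γ₁ → Subtableau (Γ ∷ path) Γ₂ →
             Subtableau path Γ

  Tableau : Label V W → Set₁
  Tableau = Subtableau []

  data MaximalBranch {path} {Γ} : Subtableau path Γ → Set₁ where
    stop  : MaximalBranch leaf
    down  : ∀ {Γ′} {r : path ⊢ Γ ⟶ Γ′} {t} →
            MaximalBranch t → MaximalBranch (unary r t)
    left  : ∀ {Γ₁ Γ₂} {r : Γ ⟶ Γ₁ ∣ Γ₂} {t₁ t₂} →
            MaximalBranch t₁ → MaximalBranch (binary r t₁ t₂)
    right : ∀ {Γ₁ Γ₂} {r : Γ ⟶ Γ₁ ∣ Γ₂} {t₁ t₂} →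
            MaximalBranch t₂ → MaximalBranch (binary r t₁ t₂)

  labels : ∀ {path Γ} {t : Subtableau path Γ} → MaximalBranch t → List (Label V W)
  labels {Γ = Γ} stop      = Γ ∷ []
  labels {Γ = Γ} (down b)  = Γ ∷ labels b
  labels {Γ = Γ} (left b)  = Γ ∷ labels b
  labels {Γ = Γ} (right b) = Γ ∷ labels b

  Clash : Label V W → Set
  Clash Γ = ∃ λ A → ∃ λ w → (A at w) ∈ Γ × (¬ᶠ A at w) ∈ Γ

  ClosedBranch : ∀ {path Γ} {t : Subtableau path Γ} → MaximalBranch t → Set₁
  ClosedBranch b = Any Clash (labels b)

  Closed : ∀ {Γ} → Tableau Γ → Set₁
  Closed t = ∀ (b : MaximalBranch t) → ClosedBranch b

HasClosedTableau : {V : Set} (W : Set) → STheory V → Set₁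
HasClosedTableau {V} W Γ = ∃ λ (t : Tableau {V} {W} ⌜ Γ ⌝) → Closed t

{-# OPTIONS --safe #-}
-- Soundness: a world assignment into a frame satisfying the label of a node can
-- be moved to one satisfying the label of some child, and a satisfied label has
-- no clash.
--
-- Completeness: the candidate frame consists of all valuations making A → B
-- true for every A ≺ B in the theory. It can fail only by being empty, or by
-- lacking a witness for a single A ⊀ B. Either way a set of propositional
-- formulas, all available at one world, is unsatisfiable, and by compactness so
-- is a finite part of it. Apply C to each variable of that part: on every branch
-- the label then determines a valuation, which falsifies some formula of the
-- part, and decomposing this formula leads to clashes between literals.
module Submission where

open import Defs
open import Axiom.ExcludedMiddle using (ExcludedMiddle)
open import Axiom.Extensionality.Propositional using (Extensionality)
open import Data.Bool.Base using (Bool; true; false; not; T) renaming (_∧_ to _&&_; _∨_ to _||_)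
open import Data.Bool.Properties
  using (T-≡; ∧-conicalˡ; ∧-conicalʳ; ⇔→≡; ¬-not; not-¬; not-injective)
  renaming (_≟_ to _≟ᵇ_)
open import Data.Empty using (⊥-elim)
open import Data.List.Base using (List; []; _∷_; _++_; map; concatMap)
open import Data.List.Relation.Unary.All as All using (All; []; _∷_)
import Data.List.Relation.Unary.All.Properties as All
open import Data.List.Relation.Unary.Any as Any using (Any; here; there)
open import Data.Product.Base using (∃; _×_; _,_; proj₁; proj₂)
open import Data.Sum.Base using (_⊎_; inj₁; inj₂; [_,_]; map₁; map₂; fromInj₂)
open import Function.Base using (_∘_; id; case_of_)
open import Function.Bundles using (_⇔_; mk⇔; mk↔ₛ′; module Equivalence)
open import Level using (0ℓ)
open import Relation.Binary.PropositionalEquality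
  using (_≡_; refl; sym; trans; cong; cong₂; subst)
open import Relation.Nullary.Decidable
  using (Dec; yes; no; isYes; toWitness; fromWitness; decidable-stable)
open import Relation.Nullary.Negation using (¬_; contradiction)
open import Relation.Unary using (Pred; _∈_; _⊆_; _∪_; ｛_｝; _≐_; Satisfiable)

-- Boolean subsets and chains.

-- Boolean values keep `Subset X` in `Set`, so that unions over collections of subsets remain at the
-- same level, and they let extensionality identify subsets with the same members.
Subset : Set → Set
Subset X = X → Bool

infix 4 _∋_ _⊑_

_∋_ : {X : Set} → Subset X → X → Set
S ∋ x = T (S x)

_⊑_ : {X : Set} → Subset X → Subset X → Set
S ⊑ S′ = ∀ x → S ∋ x → S′ ∋ x

⊑-antisym : Extensionality 0ℓ 0ℓ → {X : Set} {S S′ : Subset X} → S ⊑ S′ → S′ ⊑ S → S ≡ S′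
⊑-antisym ext p q = ext λ x → ⇔→≡
  (mk⇔ (to T-≡ ∘ p x ∘ from T-≡) (to T-≡ ∘ q x ∘ from T-≡))
  where open Equivalence

IsChain : {X : Set} → Subset (Subset X) → Set
IsChain C = ∀ {S S′} → C ∋ S → C ∋ S′ → S ⊑ S′ ⊎ S′ ⊑ S

-- Dependence of truth values on finitely many variables.

vars : {V : Set} → Formula V → List V
vars (var p)  = p ∷ []
vars (¬ᶠ A)   = vars A
vars (A ∧ᶠ B) = vars A ++ vars B
vars (A ∨ᶠ B) = vars A ++ vars B
vars (A →ᶠ B) = vars A ++ vars B

eval-cong : {V : Set} {u w : Valuation V} (A : Formula V) →
            All (λ p → u p ≡ w p) (vars A) → eval u A ≡ eval w A
eval-cong (var p)  (e ∷ []) = e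
eval-cong (¬ᶠ A)   es = cong not (eval-cong A es)
eval-cong (A ∧ᶠ B) es =
  cong₂ _&&_ (eval-cong A (All.++⁻ˡ (vars A) es)) (eval-cong B (All.++⁻ʳ (vars A) es))
eval-cong (A ∨ᶠ B) es =
  cong₂ _||_ (eval-cong A (All.++⁻ˡ (vars A) es)) (eval-cong B (All.++⁻ʳ (vars A) es))
eval-cong (A →ᶠ B) es =
  cong₂ _||_ (cong not (eval-cong A (All.++⁻ˡ (vars A) es))) (eval-cong B (All.++⁻ʳ (vars A) es))

infix 4 _⊩_

_⊩_ : {V : Set} → Valuation V → Pred (Formula V) 0ℓ
w ⊩ A = eval w A ≡ true

module _ (em : ExcludedMiddle 0ℓ) where

  by-contradiction : {P : Set} → ¬ ¬ P → P
  by-contradiction = decidable-stable em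

  ⟦_⟧ : {X : Set} → Pred X 0ℓ → Subset X
  ⟦ P ⟧ x = isYes (em {P x})

  ∈⟦⟧⁺ : {X : Set} (P : Pred X 0ℓ) {x : X} → P x → ⟦ P ⟧ ∋ x
  ∈⟦⟧⁺ P = fromWitness

  ∈⟦⟧⁻ : {X : Set} (P : Pred X 0ℓ) {x : X} → ⟦ P ⟧ ∋ x → P x
  ∈⟦⟧⁻ P = toWitness

  Member : {X : Set} → Subset (Subset X) → Pred X 0ℓ
  Member C x = ∃ λ S → C ∋ S × S ∋ x

  ⋃ : {X : Set} → Subset (Subset X) → Subset X
  ⋃ C = ⟦ Member C ⟧

  ⊑-⋃ : {X : Set} {C : Subset (Subset X)} {S : Subset X} → C ∋ S → S ⊑ ⋃ C
  ⊑-⋃ {C = C} c x s = ∈⟦⟧⁺ (Member C) (_ , c , s)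

  insert : {X : Set} → X → Subset X → Subset X
  insert x S = ⟦ (λ y → x ≡ y ⊎ S ∋ y) ⟧

  -- Zorn's lemma for properties of subsets.

  module _ (ext : Extensionality 0ℓ 0ℓ) {X : Set} (P : Pred (Subset X) 0ℓ) where

    Extension : Subset X → Pred X 0ℓ
    Extension S x = ¬ (S ∋ x) × P (insert x S)

    extend : (S : Subset X) → Dec (∃ (Extension S)) → Subset X
    extend S (yes (x , _)) = insert x S
    extend S (no _)        = S

    next : Subset X → Subset X
    next S = extend S em

    ⊑-next : (S : Subset X) → S ⊑ next S
    ⊑-next S = go em
      where
      go : (d : Dec (∃ (Extension S))) → S ⊑ extend S d
      go (yes (x , _)) _ s = ∈⟦⟧⁺ (λ y → x ≡ y ⊎ S ∋ y) (inj₂ s)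
      go (no _)        _ s = s

    -- The transfinite iteration of next from the empty set, ordinals being
    -- replaced by an inductive definition.
    data Tower : Subset X → Set where
      next-tower : ∀ {S} → Tower S → Tower (next S)
      ⋃-tower    : ∀ C → (∀ {S} → C ∋ S → Tower S) → Tower (⋃ C)

    -- The invariant behind linearity: nothing in the tower lies strictly between `S′` and
    -- `next S′`.
    Comparable : Subset X → Subset X → Set
    Comparable S S′ = S ⊑ S′ ⊎ next S′ ⊑ S

    next-comparable : ∀ {S S′} → Comparable S S′ → Comparable S′ S → Comparable (next S) S′
    next-comparable {S} (inj₂ q) _ = inj₂ λ x → ⊑-next S x ∘ q x
    next-comparable (inj₁ _) (inj₂ q) = inj₁ q
    -- The two inclusions identify `S` with `S′`, hence `next S` with `next S′`.
    next-comparable {S} {S′} (inj₁ p) (inj₁ q)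
      with refl ← ⊑-antisym ext {S = S} {S′ = S′} p q = inj₂ λ _ → id

    ⋃-comparable : ∀ C {S′} → (∀ {S} → C ∋ S → Comparable S S′) → Comparable (⋃ C) S′
    ⋃-comparable C {S′} h with em {∃ λ S → C ∋ S × next S′ ⊑ S}
    ... | yes (S , c , q) = inj₂ λ x → ⊑-⋃ {C = C} c x ∘ q x
    ... | no ¬q = inj₁ λ x s → case ∈⟦⟧⁻ (Member C) s of λ where
      (S , c , s′) → [ (λ p → p x s′) , (λ q → contradiction (S , c , q) ¬q) ] (h c)

    -- A nested induction. The successor case needs the comparison in both orders; for fixed `t`,
    -- `flipped` obtains the reverse one by an inner induction on the second tower.
    tower-comparable : ∀ {S S′} → Tower S → Tower S′ → Comparable S S′
    tower-comparable (⋃-tower C h) t′ = ⋃-comparable C λ c → tower-comparable (h c) t′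
    tower-comparable (next-tower {S} t) t′ = next-comparable (tower-comparable t t′) (flipped t′)
      where
      flipped : ∀ {S′} → Tower S′ → Comparable S′ S
      flipped (next-tower t′)  = next-comparable (flipped t′) (tower-comparable t t′)
      flipped (⋃-tower C h)    = ⋃-comparable C λ c → flipped (h c)

    tower-linear : ∀ {S S′} → Tower S → Tower S′ → S ⊑ S′ ⊎ S′ ⊑ S
    tower-linear {S′ = S′} t t′ = map₂ (λ q x → q x ∘ ⊑-next S′ x) (tower-comparable t t′)

    -- The union `M` of the whole tower belongs to the tower, hence so does `next M`, and
    -- `next M ⊑ M`. This leaves nothing outside `M` that could be inserted while preserving `P`.
    -- The empty chain provides the start of the iteration.
    zorn : (∀ C → (∀ {S} → C ∋ S → P S) → IsChain C → P (⋃ C)) →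
           ∃ λ M → P M × (∀ x → P (insert x M) → M ∋ x)
    zorn P-⋃ = M , P-tower M-tower , maximal em (⊑-⋃ {C = ⟦ Tower ⟧} (∈⟦⟧⁺ Tower (next-tower M-tower)))
      where
      P-extend : ∀ {S} (d : Dec (∃ (Extension S))) → P S → P (extend S d)
      P-extend (yes (_ , _ , p)) _ = p
      P-extend (no _)            p = p

      P-tower : ∀ {S} → Tower S → P S
      P-tower (next-tower t) = P-extend em (P-tower t)
      P-tower (⋃-tower C h)  = P-⋃ C (λ c → P-tower (h c)) (λ c c′ → tower-linear (h c) (h c′))

      M : Subset X
      M = ⋃ ⟦ Tower ⟧

      M-tower : Tower M
      M-tower = ⋃-tower ⟦ Tower ⟧ (∈⟦⟧⁻ Tower)

      maximal : (d : Dec (∃ (Extension M))) → extend M d ⊑ M → ∀ x → P (insert x M) → M ∋ x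
      maximal (yes (y , y∉M , _)) M-closed _ _ =
        contradiction (M-closed y (∈⟦⟧⁺ (λ z → y ≡ z ⊎ M ∋ z) (inj₁ refl))) y∉M
      maximal (no none) _ x p = by-contradiction λ x∉M → none (x , x∉M , p)

  -- Each listed element of the union lies in some member of the chain, and the largest of these
  -- finitely many members serves for all. The second alternative takes care of the empty chain,
  -- which has no member to offer.
  chain-finite : {X : Set} {C : Subset (Subset X)} → IsChain C → (xs : List X) →
                 (∃ λ S → C ∋ S × All (λ x → ⋃ C ∋ x → S ∋ x) xs) ⊎ All (λ x → ¬ (⋃ C ∋ x)) xs
  chain-finite chain [] = inj₂ []
  chain-finite {C = C} chain (x ∷ xs) with em {⋃ C ∋ x} | chain-finite {C = C} chain xs
  ... | no x∉   | inj₁ (S , c , ss) = inj₁ (S , c , (λ x∈ → contradiction x∈ x∉) ∷ ss)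
  ... | no x∉   | inj₂ ns           = inj₂ (x∉ ∷ ns)
  ... | yes x∈  | r with ∈⟦⟧⁻ (Member C) x∈
  ...   | S′ , c′ , x∈S′ with r
  ...     | inj₂ ns = inj₁ (S′ , c′ , (λ _ → x∈S′) ∷ All.map (λ n y → contradiction y n) ns)
  ...     | inj₁ (S , c , ss) with chain c c′
  ...       | inj₁ S⊑S′ = inj₁ (S′ , c′ , (λ _ → x∈S′) ∷ All.map (λ s y → S⊑S′ _ (s y)) ss)
  ...       | inj₂ S′⊑S = inj₁ (S , c , (λ _ → S′⊑S _ x∈S′) ∷ ss)

  -- Compactness of propositional logic.

  module _ (ext : Extensionality 0ℓ 0ℓ) {V : Set} (F : Pred (Formula V) 0ℓ) where

    -- A set S of pairs (p , b) is read as the partial valuation sending p to b.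
    Agrees : Subset (V × Bool) → Valuation V → Pred (V × Bool) 0ℓ
    Agrees S u (p , b) = S ∋ (p , b) → u p ≡ b

    -- The list `xs` is arbitrary because `Agrees` constrains nothing outside `S`; the same list can
    -- thus be tested against different sets, such as a union and a member of the chain.
    FinitelyConsistent : Pred (Subset (V × Bool)) 0ℓ
    FinitelyConsistent S = ∀ K xs → All F K → ∃ λ u → All (u ⊩_) K × All (Agrees S u) xs

    module _ (fin-sat : ∀ K → All F K → ∃ λ u → All (u ⊩_) K) where

      ⋃-consistent : ∀ C → (∀ {S} → C ∋ S → FinitelyConsistent S) → IsChain C → FinitelyConsistent (⋃ C)
      ⋃-consistent C h chain K xs K⊆F with chain-finite {C = C} chain xs
      ... | inj₁ (S , c , ss) =
        let u , sat , ag = h c K xs K⊆F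
        in  u , sat , All.zipWith (λ (s , a) → a ∘ s) (ss , ag)
      ... | inj₂ ns =
        let u , sat = fin-sat K K⊆F
        in  u , sat , All.map (λ n x∈ → contradiction x∈ n) ns

      -- A failure of consistency has finite witnesses; the inserted pair is taken out of the
      -- constraints and becomes the excluded equation.
      insert-inconsistent : ∀ {S} p b → ¬ FinitelyConsistent (insert (p , b) S) →
        ∃ λ K → ∃ λ xs → All F K × (∀ u → All (u ⊩_) K → All (Agrees S u) xs → ¬ (u p ≡ b))
      insert-inconsistent {S} p b ¬con = by-contradiction λ none → ¬con λ K xs K⊆F →
        by-contradiction λ no-u → none (K , xs , K⊆F , λ u sat ag e →
          no-u (u , sat , All.map (λ {x} a x∈ → agrees e a (∈⟦⟧⁻ (λ y → (p , b) ≡ y ⊎ S ∋ y) x∈)) ag))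
        where
        agrees : ∀ {u x} → u p ≡ b → Agrees S u x → (p , b) ≡ x ⊎ S ∋ x → u (proj₁ x) ≡ proj₂ x
        agrees e a (inj₁ refl) = e
        agrees e a (inj₂ s)    = a s

      -- A maximal finitely consistent `M` contains a value for every variable, and a single formula
      -- of `F` only tests finitely many of these values.
      compactness : ∃ λ w → F ⊆ (w ⊩_)
      compactness with zorn ext FinitelyConsistent ⋃-consistent
      ... | M , con , maximal = w , λ {A} A∈F →
        let u , sat , ag = con (A ∷ []) (map (λ p → p , w p) (vars A)) (A∈F ∷ [])
        in  trans (sym (eval-cong A (All.map (λ {p} a → a (M-w p)) (All.map⁻ ag)))) (All.head sat)
        where
        w : Valuation V
        w p = M (p , true)

        -- If both values at `p` were missing from `M`, each would be excluded by finite data; a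
        -- valuation consistent with both sets of data at once could then take neither value.
        decides : ∀ p → ¬ (M ∋ (p , true)) → M ∋ (p , false)
        decides p ¬t = by-contradiction λ ¬f →
          let K₁ , xs₁ , K₁⊆F , no₁ = insert-inconsistent p true  (¬t ∘ maximal (p , true))
              K₂ , xs₂ , K₂⊆F , no₂ = insert-inconsistent p false (¬f ∘ maximal (p , false))
              u , sat , ag = con (K₁ ++ K₂) (xs₁ ++ xs₂) (All.++⁺ K₁⊆F K₂⊆F)
              ¬true  = no₁ u (All.++⁻ˡ K₁ sat) (All.++⁻ˡ xs₁ ag)
              ¬false = no₂ u (All.++⁻ʳ K₁ sat) (All.++⁻ʳ xs₁ ag)
          in  ¬false (¬-not ¬true)

        M-w : ∀ p → M ∋ (p , w p)
        M-w p with M (p , true) in e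
        ... | true  = Equivalence.from T-≡ e
        ... | false = decides p (subst T e)

-- Closed tableaux from unsatisfiability at one world.

module _ {V W : Set} where

  ClosedSub : ∀ {path} {Γ : Label V W} → Subtableau path Γ → Set₁
  ClosedSub t = ∀ (b : MaximalBranch t) → ClosedBranch b

  -- Quantifying over `path` lets a refutation be grafted at any depth.
  Refutable : Label V W → Set₁
  Refutable Γ = ∀ path → ∃ λ (t : Subtableau path Γ) → ClosedSub t

  clash-refutable : ∀ {Γ} → Clash Γ → Refutable Γ
  clash-refutable c _ = leaf , λ { stop → here c }

  -- Stated for one fixed `path`, which allows the `⊀-rule`, whose freshness condition depends on
  -- the path.
  unary-closed : ∀ {path Γ Γ′} → path ⊢ Γ ⟶ Γ′ → Refutable Γ′ →
                 ∃ λ (t : Subtableau path Γ) → ClosedSub t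
  unary-closed r h = let t , c = h _ in unary r t , λ { (down b) → there (c b) }

  unary-refutable : ∀ {Γ Γ′} → (∀ {path} → path ⊢ Γ ⟶ Γ′) → Refutable Γ′ → Refutable Γ
  unary-refutable r h _ = unary-closed r h

  binary-refutable : ∀ {Γ Γ₁ Γ₂} → Γ ⟶ Γ₁ ∣ Γ₂ → Refutable Γ₁ → Refutable Γ₂ → Refutable Γ
  binary-refutable r h₁ h₂ path =
    let t₁ , c₁ = h₁ _
        t₂ , c₂ = h₂ _
    in  binary r t₁ t₂ , λ { (left b) → there (c₁ b) ; (right b) → there (c₂ b) }

  -- Keeping the decomposed formula in Δ makes labels grow along branches.
  absorb : ∀ {Γ : Label V W} {φ} → φ ∈ Γ → Γ ≐ Γ ⨾ φ
  absorb φ∈ = inj₁ , λ { (inj₁ x) → x ; (inj₂ refl) → φ∈ }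

  record Literal (Γ : Label V W) (v : W) (w : Valuation V) (p : V) : Set where
    constructor literal
    field
      positive : w p ≡ true  → (var p at v) ∈ Γ
      negative : w p ≡ false → (¬ᶠ var p at v) ∈ Γ

  module _ {v : W} {w : Valuation V} where

    weaken : ∀ {Γ φ ps} → All (Literal Γ v w) ps → All (Literal (Γ ⨾ φ) v w) ps
    weaken = All.map λ (literal t f) → literal (inj₁ ∘ t) (inj₁ ∘ f)

    -- Simultaneous induction on `A`. A formula false under `w` yields a false formula on every
    -- child: both parts are false when the rule branches, and at least one is when it does not. A
    -- false literal clashes with the true one supplied by `Literal`.
    false-refutable : ∀ {Γ} A → All (Literal Γ v w) (vars A) →
                      (A at v) ∈ Γ → eval w A ≡ false → Refutable Γ
    true-refutable  : ∀ {Γ} A → All (Literal Γ v w) (vars A) →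
                      (¬ᶠ A at v) ∈ Γ → eval w A ≡ true → Refutable Γ

    false-refutable (var p) (literal _ f ∷ []) A∈ e = clash-refutable (var p , v , A∈ , f e)
    false-refutable (¬ᶠ A) ls A∈ e = true-refutable A ls A∈ (not-injective e)
    false-refutable (A ∧ᶠ B) ls A∈ e =
      unary-refutable (∧-rule _ A B v (absorb A∈)) (helper (eval w A) refl e)
      where
      helper : ∀ a → eval w A ≡ a → (a && eval w B) ≡ false → Refutable _
      helper false eA _  = false-refutable A (weaken (weaken (All.++⁻ˡ (vars A) ls))) (inj₁ (inj₂ refl)) eA
      helper true  _  eB = false-refutable B (weaken (weaken (All.++⁻ʳ (vars A) ls))) (inj₂ refl) eB
    false-refutable (A ∨ᶠ B) ls A∈ e with eval w A in eA | e
    ... | false | eB = binary-refutable (∨-rule _ A B v (absorb A∈))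
      (false-refutable A (weaken (All.++⁻ˡ (vars A) ls)) (inj₂ refl) eA)
      (false-refutable B (weaken (All.++⁻ʳ (vars A) ls)) (inj₂ refl) eB)
    false-refutable (A →ᶠ B) ls A∈ e with eval w A in eA | e
    ... | true | eB = binary-refutable (→-rule _ A B v (absorb A∈))
      (true-refutable  A (weaken (All.++⁻ˡ (vars A) ls)) (inj₂ refl) eA)
      (false-refutable B (weaken (All.++⁻ʳ (vars A) ls)) (inj₂ refl) eB)

    true-refutable (var p) (literal t _ ∷ []) A∈ e = clash-refutable (var p , v , t e , A∈)
    true-refutable (¬ᶠ A) ls A∈ e =
      unary-refutable (¬¬-rule _ A v (absorb A∈))
        (false-refutable A (weaken ls) (inj₂ refl) (not-injective e))
    true-refutable (A ∧ᶠ B) ls A∈ e with eval w A in eA | e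
    ... | true | eB = binary-refutable (¬∧-rule _ A B v (absorb A∈))
      (true-refutable A (weaken (All.++⁻ˡ (vars A) ls)) (inj₂ refl) eA)
      (true-refutable B (weaken (All.++⁻ʳ (vars A) ls)) (inj₂ refl) eB)
    true-refutable (A ∨ᶠ B) ls A∈ e =
      unary-refutable (¬∨-rule _ A B v (absorb A∈)) (helper (eval w A) refl e)
      where
      helper : ∀ a → eval w A ≡ a → (a || eval w B) ≡ true → Refutable _
      helper true  eA _  = true-refutable A (weaken (weaken (All.++⁻ˡ (vars A) ls))) (inj₁ (inj₂ refl)) eA
      helper false _  eB = true-refutable B (weaken (weaken (All.++⁻ʳ (vars A) ls))) (inj₂ refl) eB
    true-refutable (A →ᶠ B) ls A∈ e =
      unary-refutable (¬→-rule _ A B v (absorb A∈)) (helper (eval w A) refl e)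
      where
      helper : ∀ a → eval w A ≡ a → (not a || eval w B) ≡ true → Refutable _
      helper false eA _  = false-refutable A (weaken (weaken (All.++⁻ˡ (vars A) ls))) (inj₁ (inj₂ refl)) eA
      helper true  _  eB = true-refutable  B (weaken (weaken (All.++⁻ʳ (vars A) ls))) (inj₂ refl) eB

  Decided : W → Label V W → Pred V 0ℓ
  Decided v Γ p = (var p at v) ∈ Γ ⊎ (¬ᶠ var p at v) ∈ Γ

  -- The continuation `k` is called once for each combination of choices and sees only that the
  -- label has grown and decides all of `ps`.
  decide-vars : ∀ {Γ} v ps → (∀ {Γ′} → Γ ⊆ Γ′ → All (Decided v Γ′) ps → Refutable Γ′) → Refutable Γ
  decide-vars v []       k = k id []
  decide-vars v (p ∷ ps) k = binary-refutable (C-rule _ (var p) v (id , id))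
    (decide-vars v ps λ sub ds → k (sub ∘ inj₁) (inj₁ (sub (inj₂ refl)) ∷ ds))
    (decide-vars v ps λ sub ds → k (sub ∘ inj₁) (inj₂ (sub (inj₂ refl)) ∷ ds))

  -- What a label demands of the world `v`. The formula `A →ᶠ B` need not be in the label: the
  -- `≺-rule` at `v` branches exactly as the `→-rule` would on it.
  data Available (Γ : Label V W) (v : W) : Pred (Formula V) 0ℓ where
    at-world : ∀ {A}   → (A at v) ∈ Γ         → Available Γ v A
    from-≺   : ∀ {A B} → strict (A ≺ B) ∈ Γ → Available Γ v (A →ᶠ B)

  false-available-refutable : ∀ {Γ Γ′ v w A} → Γ ⊆ Γ′ → All (Literal Γ′ v w) (vars A) →
                              Available Γ v A → eval w A ≡ false → Refutable Γ′
  false-available-refutable {A = A} sub ls (at-world A∈) e = false-refutable A ls (sub A∈) e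
  false-available-refutable {v = v} {w = w} sub ls (from-≺ {A} {B} φ∈) e with eval w A in eA | e
  ... | true | eB = binary-refutable (≺-rule _ A B v (absorb (sub φ∈)))
    (true-refutable  A (weaken (All.++⁻ˡ (vars A) ls)) (inj₂ refl) eA)
    (false-refutable B (weaken (All.++⁻ʳ (vars A) ls)) (inj₂ refl) eB)

  module _ (em : ExcludedMiddle 0ℓ) where

    read-off : W → Label V W → Valuation V
    read-off v Γ = ⟦_⟧ em (λ p → (var p at v) ∈ Γ)

    -- A variable read off as `false` has no positive literal in the label, so its decision must be
    -- the negative one.
    read-off-literal : ∀ {v Γ} → Decided v Γ ⊆ Literal Γ v (read-off v Γ)
    read-off-literal {v} {Γ} d = literal
      (λ e → ∈⟦⟧⁻ em (λ q → (var q at v) ∈ Γ) (Equivalence.from T-≡ e))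
      (λ e → fromInj₂ (λ t → ⊥-elim (subst T e (∈⟦⟧⁺ em (λ q → (var q at v) ∈ Γ) t))) d)

    finite-refutable : ∀ {Γ} v K → All (Available Γ v) K → ¬ (∃ λ w → All (w ⊩_) K) → Refutable Γ
    finite-refutable {Γ} v K avail unsat = decide-vars v (concatMap vars K) λ {Γ′} sub ds →
      let w = read-off v Γ′
          lss = All.map⁻ (All.concat⁻ {xss = map vars K} (All.map (read-off-literal {v} {Γ′}) ds))
          -- The valuation `w`, and with it the falsified formula of `K`, varies from branch to
          -- branch.
          some-false = All.¬All⇒Any¬ (λ A → eval w A ≟ᵇ true) K (λ sat → unsat (w , sat))
          (a , ls) , ¬true = All.lookupAny (All.zip (avail , lss)) some-false
      in  false-available-refutable sub ls a (¬-not ¬true)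

    -- Compactness in contrapositive form supplies the finite unsatisfiable part.
    unsatisfiable-refutable : Extensionality 0ℓ 0ℓ → ∀ {Γ} v →
      ¬ (∃ λ w → Available Γ v ⊆ (w ⊩_)) → Refutable Γ
    unsatisfiable-refutable ext {Γ} v unsat =
      let K , avail , K-unsat = finite-part in finite-refutable v K avail K-unsat
      where
      finite-part : ∃ λ K → All (Available Γ v) K × ¬ (∃ λ w → All (w ⊩_) K)
      finite-part = by-contradiction em λ none → unsat
        (compactness em ext (Available Γ v) λ K avail →
          by-contradiction em λ K-unsat → none (K , avail , K-unsat))

-- Strict negation as classical negation in a frame.

⊨-consistent : {V : Set} {R : Frame V} (φ : SFormula V) → R ⊨ φ → ¬ (R ⊨ -ˢ φ)
⊨-consistent (A ≺ B) h (w , w∈R , eA , eB) = case h w w∈R of λ where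
  (inj₁ f) → case trans (sym eA) f of λ ()
  (inj₂ t) → case trans (sym eB) t of λ ()
⊨-consistent (A ⊀ B) (w , w∈R , eA , eB) h = case h w w∈R of λ where
  (inj₁ f) → case trans (sym eA) f of λ ()
  (inj₂ t) → case trans (sym eB) t of λ ()

⊨-complete : ExcludedMiddle 0ℓ → {V : Set} {R : Frame V} (φ : SFormula V) → ¬ (R ⊨ φ) → R ⊨ -ˢ φ
⊨-complete em {R = R} (A ≺ B) ¬φ = by-contradiction em λ none → ¬φ λ w w∈R → helper w w∈R none
  where
  helper : ∀ w → w ∈ Frame.valuations R →
           ¬ (∃ λ w → w ∈ Frame.valuations R × eval w A ≡ true × eval w B ≡ false) →
           eval w A ≡ false ⊎ eval w B ≡ true
  helper w w∈R none with eval w A in eA | eval w B in eB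
  ... | false | _     = inj₁ refl
  ... | true  | true  = inj₂ refl
  ... | true  | false = contradiction (w , w∈R , eA , eB) none
⊨-complete em (A ⊀ B) ¬φ w w∈R with eval w A in eA | eval w B in eB
... | false | _     = inj₁ refl
... | true  | true  = inj₂ refl
... | true  | false = contradiction (w , w∈R , eA , eB) ¬φ

∨-true : ∀ a b → (a || b) ≡ true → a ≡ true ⊎ b ≡ true
∨-true true  _ _ = inj₁ refl
∨-true false _ e = inj₂ e

¬∨-true : ∀ a b → not (a || b) ≡ true → not a ≡ true × not b ≡ true
¬∨-true false _ e = refl , e

¬∧-true : ∀ a b → not (a && b) ≡ true → not a ≡ true ⊎ not b ≡ true
¬∧-true false _ _ = inj₁ refl
¬∧-true true  _ e = inj₂ e

¬→-true : ∀ a b → not (not a || b) ≡ true → a ≡ true × not b ≡ true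
¬→-true true _ e = refl , e

excluded : ∀ a → a ≡ true ⊎ not a ≡ true
excluded true  = inj₁ refl
excluded false = inj₂ refl

-- Soundness.

module _ {V W : Set} (R : Frame V) where

  open Frame R

  Worlds : Set
  Worlds = W → Satisfiable valuations

  Holds : Worlds → Pred (TFormula V W) 0ℓ
  Holds I (strict φ) = R ⊨ φ
  Holds I (A at w)   = proj₁ (I w) ⊩ A

  Satisfies : Worlds → Label V W → Set
  Satisfies I Γ = ∀ φ → φ ∈ Γ → Holds I φ

  _⨾ʰ_ : ∀ {I Δ φ} → Satisfies I Δ → Holds I φ → Satisfies I (Δ ⨾ φ)
  (h ⨾ʰ x) _ (inj₁ y)    = h _ y
  (h ⨾ʰ x) _ (inj₂ refl) = x

  restrict : ∀ {I Γ Δ φ} → Δ ⨾ φ ⊆ Γ → Satisfies I Γ → Satisfies I Δ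
  restrict Γ⊇ h _ = h _ ∘ Γ⊇ ∘ inj₁

  branch : ∀ {I Δ φ ψ} → Satisfies I Δ → Holds I φ ⊎ Holds I ψ → Satisfies I (Δ ⨾ φ) ⊎ Satisfies I (Δ ⨾ ψ)
  branch h (inj₁ x) = inj₁ (h ⨾ʰ x)
  branch h (inj₂ y) = inj₂ (h ⨾ʰ y)

  holds⇒¬clash : ∀ {I Γ} → Satisfies I Γ → ¬ Clash Γ
  holds⇒¬clash h (A , w , A∈ , ¬A∈) = contradiction (h _ A∈) (not-¬ (not-injective (h _ ¬A∈)))

  module _ (em : ExcludedMiddle 0ℓ) where

    reassign : Worlds → W → Satisfiable valuations → Worlds
    reassign I v u w with em {w ≡ v}
    ... | yes _ = u
    ... | no  _ = I w

    reassign-same : ∀ I v u → reassign I v u v ≡ u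
    reassign-same I v u with em {v ≡ v}
    ... | yes _ = refl
    ... | no ¬p = contradiction refl ¬p

    reassign-fresh : ∀ {I v u Γ} → ¬ Mentions v Γ → Satisfies I Γ → Satisfies (reassign I v u) Γ
    reassign-fresh fresh h (strict φ) φ∈ = h _ φ∈
    reassign-fresh {v = v} fresh h (A at w) A∈ with em {w ≡ v}
    ... | yes refl = contradiction (A , A∈) fresh
    ... | no _     = h _ A∈

    -- Only the `⊀-rule` changes the assignment: it sends `v` to the witness in `R`, and formulas of
    -- `Δ` stay true because `Γ` does not mention `v`.
    unary-sound : ∀ {path Γ Γ′} I → path ⊢ Γ ⟶ Γ′ → Satisfies I Γ → ∃ λ I′ → Satisfies I′ Γ′
    unary-sound I (¬∨-rule Δ A B w (_ , Γ⊇)) h =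
      let a , b = ¬∨-true (eval (proj₁ (I w)) A) _ (h _ (Γ⊇ (inj₂ refl)))
      in  I , ((restrict Γ⊇ h ⨾ʰ a) ⨾ʰ b)
    unary-sound I (∧-rule Δ A B w (_ , Γ⊇)) h =
      let e = h _ (Γ⊇ (inj₂ refl))
      in  I , ((restrict Γ⊇ h ⨾ʰ ∧-conicalˡ _ _ e) ⨾ʰ ∧-conicalʳ (eval (proj₁ (I w)) A) _ e)
    unary-sound I (¬→-rule Δ A B w (_ , Γ⊇)) h =
      let a , b = ¬→-true (eval (proj₁ (I w)) A) _ (h _ (Γ⊇ (inj₂ refl)))
      in  I , ((restrict Γ⊇ h ⨾ʰ a) ⨾ʰ b)
    unary-sound I (⊀-rule Δ A B v (_ , Γ⊇) (fresh ∷ _)) h =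
      let u , u∈R , a , b = h _ (Γ⊇ (inj₂ refl))
          I′ = reassign I v (u , u∈R)
          moved = sym (reassign-same I v (u , u∈R))
      in  I′ , ((restrict Γ⊇ (reassign-fresh fresh h)
                 ⨾ʰ subst (λ x → proj₁ x ⊩ A) moved a)
                 ⨾ʰ subst (λ x → proj₁ x ⊩ ¬ᶠ B) moved (cong not b))
    unary-sound I (¬¬-rule Δ A w (_ , Γ⊇)) h =
      I , (restrict Γ⊇ h ⨾ʰ not-injective (not-injective (h _ (Γ⊇ (inj₂ refl)))))

    binary-sound : ∀ {Γ Γ₁ Γ₂} I → Γ ⟶ Γ₁ ∣ Γ₂ → Satisfies I Γ → Satisfies I Γ₁ ⊎ Satisfies I Γ₂
    binary-sound I (∨-rule Δ A B w (_ , Γ⊇)) h =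
      branch (restrict Γ⊇ h) (∨-true (eval (proj₁ (I w)) A) _ (h _ (Γ⊇ (inj₂ refl))))
    binary-sound I (¬∧-rule Δ A B w (_ , Γ⊇)) h =
      branch (restrict Γ⊇ h) (¬∧-true (eval (proj₁ (I w)) A) _ (h _ (Γ⊇ (inj₂ refl))))
    binary-sound I (→-rule Δ A B w (_ , Γ⊇)) h =
      branch (restrict Γ⊇ h) (∨-true (not (eval (proj₁ (I w)) A)) _ (h _ (Γ⊇ (inj₂ refl))))
    binary-sound I (≺-rule Δ A B w (_ , Γ⊇)) h =
      branch (restrict Γ⊇ h) (map₁ (cong not) (h _ (Γ⊇ (inj₂ refl)) (proj₁ (I w)) (proj₂ (I w))))
    binary-sound I (C-rule Δ A w (_ , Γ⊇)) h =
      branch (λ _ → h _ ∘ Γ⊇) (excluded (eval (proj₁ (I w)) A))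

    -- Descend to a satisfied child. The current label has no clash, so closedness of a branch
    -- passes to its tail, until a leaf leaves no place for a clash.
    holds⇒¬closed : ∀ {path Γ} I → Satisfies I Γ → (t : Subtableau path Γ) → ¬ ClosedSub t
    holds⇒¬closed I h leaf c = case c stop of λ { (here clash) → holds⇒¬clash h clash }
    holds⇒¬closed I h (unary r t) c =
      let I′ , h′ = unary-sound I r h
      in  holds⇒¬closed I′ h′ t (Any.tail (holds⇒¬clash h) ∘ c ∘ down)
    holds⇒¬closed I h (binary r t₁ t₂) c = case binary-sound I r h of λ where
      (inj₁ h₁) → holds⇒¬closed I h₁ t₁ (Any.tail (holds⇒¬clash h) ∘ c ∘ left)
      (inj₂ h₂) → holds⇒¬closed I h₂ t₂ (Any.tail (holds⇒¬clash h) ∘ c ∘ right)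

soundness : ExcludedMiddle 0ℓ → {V W : Set} (Γ : STheory V) (φ : SFormula V) →
            HasClosedTableau W (Γ ∪ ｛ -ˢ φ ｝) → StrictConsequence Γ φ
soundness em {W = W} Γ φ (t , closed) R R⊨Γ = by-contradiction em λ ¬φ →
  -- The root label mentions no world variable, so a constant assignment will do.
  holds⇒¬closed R em (λ _ → Frame.nonempty R) (root ¬φ) t closed
  where
  root : ¬ (R ⊨ φ) → Satisfies {W = W} R (λ _ → Frame.nonempty R) ⌜ Γ ∪ ｛ -ˢ φ ｝ ⌝
  root ¬φ (strict ψ) (inj₁ ψ∈Γ)  = R⊨Γ ψ ψ∈Γ
  root ¬φ (strict _) (inj₂ refl) = ⊨-complete em φ ¬φ

-- Completeness.

infinite⇒inhabited : ExcludedMiddle 0ℓ → {W : Set} → Infinite W → W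
infinite⇒inhabited em infinite = by-contradiction em λ empty → infinite
  (0 , mk↔ₛ′ (λ w → contradiction w empty) (λ ()) (λ ()) (λ w → contradiction w empty))

module _ (em : ExcludedMiddle 0ℓ) (ext : Extensionality 0ℓ 0ℓ) {V W : Set} (v : W) where

  -- The largest candidate: every frame satisfying the strict implications of `Θ` lies inside it,
  -- and enlarging a frame preserves witnesses of strict nonimplications.
  Admissible : STheory V → Pred (Valuation V) 0ℓ
  Admissible Θ w = ∀ {A B} → (A ≺ B) ∈ Θ → w ⊩ A →ᶠ B

  Unwitnessed : STheory V → Set
  Unwitnessed Θ = ∃ λ A → ∃ λ B → (A ⊀ B) ∈ Θ ×
    ¬ (∃ λ w → w ∈ Admissible Θ × eval w A ≡ true × eval w B ≡ false)

  -- After one `⊀-rule`, a valuation satisfying everything available at `v` would be an admissible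
  -- witness for `A ⊀ B`.
  unwitnessed-tableau : ∀ Θ → Unwitnessed Θ → HasClosedTableau W Θ
  unwitnessed-tableau Θ (A , B , φ∈ , unwitnessed) =
    unary-closed (⊀-rule ⌜ Θ ⌝ A B v (absorb φ∈) ((λ ()) ∷ []))
      (unsatisfiable-refutable em ext v λ (w , sat) → unwitnessed
        ( w
        , (λ ψ∈ → sat (from-≺ (inj₁ (inj₁ ψ∈))))
        , sat (at-world (inj₁ (inj₂ refl)))
        , not-injective (sat (at-world (inj₂ refl)))))

  model-or-tableau : ∀ Θ → (∃ λ R → R ⊨ᵗ Θ) ⊎ HasClosedTableau W Θ
  model-or-tableau Θ with em {Satisfiable (Admissible Θ)} | em {Unwitnessed Θ}
  ... | no none | _ =
    -- Here the strict implications alone are contradictory at `v`.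
    inj₂ (unsatisfiable-refutable em ext v (λ (w , sat) → none (w , λ φ∈ → sat (from-≺ φ∈))) [])
  ... | yes _ | yes u = inj₂ (unwitnessed-tableau Θ u)
  ... | yes inhabited | no ¬u = inj₁ (R , models)
    where
    R : Frame V
    R = record { valuations = Admissible Θ ; nonempty = inhabited }

    models : R ⊨ᵗ Θ
    models (A ≺ B) φ∈ w w∈R = map₁ not-injective (∨-true (not (eval w A)) _ (w∈R φ∈))
    models (A ⊀ B) φ∈ = by-contradiction em λ none → ¬u (A , B , φ∈ , none)

  -- A frame satisfying the extended theory would satisfy both `φ`, by hypothesis, and its strict
  -- negation.
  completeness : ∀ Γ φ → StrictConsequence Γ φ → HasClosedTableau W (Γ ∪ ｛ -ˢ φ ｝)
  completeness Γ φ consequence = fromInj₂ (λ (R , R⊨) →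
    contradiction (R⊨ (-ˢ φ) (inj₂ refl))
      (⊨-consistent φ (consequence R (λ ψ ψ∈ → R⊨ ψ (inj₁ ψ∈)))))
    (model-or-tableau (Γ ∪ ｛ -ˢ φ ｝))

theorem12 : ExcludedMiddle 0ℓ → Extensionality 0ℓ 0ℓ →
    (V W : Set) → Infinite V → Infinite W →
    (Γ : STheory V) (φ : SFormula V) →
    StrictConsequence Γ φ ⇔ HasClosedTableau W (Γ ∪ ｛ -ˢ φ ｝)
theorem12 em ext V W _ W-infinite Γ φ =
  mk⇔ (completeness em ext (infinite⇒inhabited em W-infinite) Γ φ) (soundness em Γ φ)
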